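{- Let $G$ be a graph and let $F_k(G)$ be its $k$-token graph. Then the Laplacian spectrum of $G$ is contained in the Laplacian spectrum of $F_k(G)$.
   Context: All graphs are finite and simple. For a graph $G$ with vertex set $[n]=\{1,\dots,n\}$ and a given integer $k$ with $1\le k\le n$, the $k$-token graph $F_k(G)$ has as vertices the $\binom{n}{k}$ $k$-subsets of $[n]$; two vertices $A,B$ are adjacent whenever their symmetric difference $A\bigtriangleup B$ is a pair $\{a,b\}$ with $a\in A$, $b\in B$ and $\{a,b\}$ an edge of $G$. The Laplacian matrix of a graph is $L=D-A$, with $A$ the adjacency matrix and $D$ the diagonal matrix of vertex degrees. The Laplacian spectrum of a graph is the multiset of eigenvalues of its Laplacian matrix, counted with multiplicity, and containment of spectra means containment of multisets.
   Formalization: The case k = n with n ≥ 2 is excluded: there the k-token graph is a single vertex with Laplacian spectrum {0}, which cannot contain the n ≥ 2 Laplacian eigenvalues of G, so the claim is false; all 1 ≤ k < n and k = n = 1 are kept. -}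

module Defs where

open import Level using (Level; _⊔_; 0ℓ) renaming (suc to lsuc)
open import Algebra.Bundles using (CommutativeRing)
open import Data.Bool using (if_then_else_)
open import Data.Bool.Properties using () renaming (_≟_ to _≟ᵇ_)
open import Data.Fin using (Fin; zero; suc)
open import Data.Fin.Properties using (inj⇒≟; any?; +↔⊎)
open import Data.Fin.Subset using (Subset; ∣_∣; _∈_; _∪_; _─_; ⁅_⁆; inside; outside) renaming (⊥ to ∅)
open import Data.Fin.Subset.Properties using (_∈?_; ∪-comm; x∈⁅x⁆; x∈p∪q⁺)
open import Data.List using (List; length; filter; _++_)
open import Data.Nat using (ℕ; zero; suc; z≤n)
open import Data.Nat.Combinatorics using (_C_; nCk+nC[k+1]≡[n+1]C[k+1]; nCk≡nC[n∸k]; nCn≡1)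
open import Data.Nat.Properties using (suc-injective) renaming (≡-irrelevant to ℕ-irrelevant)
open import Data.Product using (∃-syntax; _×_; _,_)
open import Data.Sum using (_⊎_; inj₁; inj₂)
open import Data.Sum.Function.Propositional using (_⊎-↔_)
open import Data.Vec using ([]; _∷_; count; tabulate; there)
open import Data.Vec.Properties using (≡-dec)
open import Function using (_↔_; mk↔ₛ′; Inverse)
open import Function.Construct.Composition using (_↔-∘_)
open import Function.Construct.Identity using (↔-id)
open import Function.Construct.Symmetry using (↔-sym)
open import Function.Properties.Inverse using (Inverse⇒Injection)
open import Relation.Binary using (Rel; Decidable; IsDecTotalOrder; DecidableEquality)
open import Relation.Binary.PropositionalEquality using (_≡_; refl; sym; trans; cong; subst)
open import Relation.Nullary using (¬_)
open import Relation.Nullary.Decidable using (_×-dec_; ⌊_⌋)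
import Algebra.Definitions.RawMonoid as RawMonoidDefs
import Data.List.Relation.Binary.Permutation.Setoid as SetoidPermutation

private
  variable
    c ℓ₁ ℓ₂ : Level
    n k : ℕ
    V : Set

-- The library has no real numbers.  ℝ enters as one instance of an ordered
-- field, and eigenvalues below are those lying in the given ordered field.
record OrderedField c ℓ₁ ℓ₂ : Set (lsuc (c ⊔ ℓ₁ ⊔ ℓ₂)) where
  field
    commutativeRing : CommutativeRing c ℓ₁
  open CommutativeRing commutativeRing public
  field
    _≼_             : Rel Carrier ℓ₂
    isDecTotalOrder : IsDecTotalOrder _≈_ _≼_
    +-monoˡ-≼       : ∀ {x y} z → x ≼ y → (x + z) ≼ (y + z)
    *-nonneg        : ∀ {x y} → 0# ≼ x → 0# ≼ y → 0# ≼ (x * y)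
    0≉1             : ¬ (0# ≈ 1#)
    inverse         : ∀ x → ¬ (x ≈ 0#) → ∃[ y ] (x * y ≈ 1#)
  open IsDecTotalOrder isDecTotalOrder public using (_≟_)

record Finite (V : Set) : Set where
  field
    card        : ℕ
    enumeration : V ↔ Fin card

  element : Fin card → V
  element = Inverse.from enumeration

  _≟ⱽ_ : DecidableEquality V
  _≟ⱽ_ = inj⇒≟ (Inverse⇒Injection enumeration)

open Finite {{...}} public

record Graph (V : Set) : Set₁ where
  field
    Adj    : Rel V 0ℓ
    adj?   : Decidable Adj
    symm   : ∀ {u v} → Adj u v → Adj v u
    irrefl : ∀ {v} → ¬ Adj v v

  degree : {{Finite V}} → V → ℕ
  degree v = count (adj? v) (tabulate element)

record KSubset (n k : ℕ) : Set where
  constructor _,ₖ_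
  field
    subset : Subset n
    size   : ∣ subset ∣ ≡ k

open KSubset public

infixl 6 _△_

_△_ : Subset n → Subset n → Subset n
A △ B = (A ─ B) ∪ (B ─ A)

TokenAdj : Graph (Fin n) → Rel (KSubset n k) 0ℓ
TokenAdj G A B = ∃[ a ] ∃[ b ]
  (a ∈ subset A × b ∈ subset B × Graph.Adj G a b × subset A △ subset B ≡ ⁅ a ⁆ ∪ ⁅ b ⁆)

private
  ─-self : (p : Subset n) → p ─ p ≡ ∅
  ─-self []            = refl
  ─-self (inside  ∷ p) = cong (outside ∷_) (─-self p)
  ─-self (outside ∷ p) = cong (outside ∷_) (─-self p)

  ∅∪∅ : ∀ n → ∅ {n} ∪ ∅ ≡ ∅
  ∅∪∅ zero    = refl
  ∅∪∅ (suc n) = cong (outside ∷_) (∅∪∅ n)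

  ∉∅ : {x : Fin n} → ¬ (x ∈ ∅)
  ∉∅ {x = suc x} (there x∈) = ∉∅ x∈

  △-self : (p : Subset n) → p △ p ≡ ∅
  △-self {n} p rewrite ─-self p = ∅∪∅ n

tokenGraph : ∀ k → Graph (Fin n) → Graph (KSubset n k)
tokenGraph k G = record
  { Adj    = TokenAdj G
  ; adj?   = λ A B → any? λ a → any? λ b →
               a ∈? subset A ×-dec b ∈? subset B ×-dec Graph.adj? G a b
               ×-dec ≡-dec _≟ᵇ_ (subset A △ subset B) (⁅ a ⁆ ∪ ⁅ b ⁆)
  ; symm   = λ { {A} {B} (a , b , a∈A , b∈B , ab , eq) →
               b , a , b∈B , a∈A , Graph.symm G ab ,
               trans (∪-comm (subset B ─ subset A) (subset A ─ subset B))
                     (trans eq (∪-comm ⁅ a ⁆ ⁅ b ⁆)) }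
  ; irrefl = λ { {A} (a , b , _ , _ , _ , eq) →
               ∉∅ (subst (a ∈_) (trans (sym eq) (△-self (subset A)))
                         (x∈p∪q⁺ (inj₁ (x∈⁅x⁆ a)))) }
  }

private
  KSubset-≡ : {A B : KSubset n k} → subset A ≡ subset B → A ≡ B
  KSubset-≡ {A = A ,ₖ p} {B = .A ,ₖ q} refl = cong (A ,ₖ_) (ℕ-irrelevant p q)

  Fin-cong : ∀ {m m′} → m ≡ m′ → Fin m ↔ Fin m′
  Fin-cong refl = ↔-id _

  nC0≡1 : ∀ n → n C 0 ≡ 1
  nC0≡1 n = trans (nCk≡nC[n∸k] {0} {n} z≤n) (nCn≡1 n)

  consOutside : KSubset n 0 ↔ KSubset (suc n) 0
  consOutside = mk↔ₛ′
    (λ { (A ,ₖ p) → (outside ∷ A) ,ₖ p })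
    (λ { ((outside ∷ A) ,ₖ p) → A ,ₖ p })
    (λ { ((outside ∷ A) ,ₖ p) → refl })
    (λ { (A ,ₖ p) → refl })

  cons : (KSubset n k ⊎ KSubset n (suc k)) ↔ KSubset (suc n) (suc k)
  cons = mk↔ₛ′
    (λ { (inj₁ (A ,ₖ p)) → (inside ∷ A) ,ₖ cong suc p
       ; (inj₂ (A ,ₖ p)) → (outside ∷ A) ,ₖ p })
    (λ { ((inside  ∷ A) ,ₖ p) → inj₁ (A ,ₖ suc-injective p)
       ; ((outside ∷ A) ,ₖ p) → inj₂ (A ,ₖ p) })
    (λ { ((inside  ∷ A) ,ₖ p) → KSubset-≡ refl
       ; ((outside ∷ A) ,ₖ p) → refl })
    (λ { (inj₁ (A ,ₖ p)) → cong inj₁ (KSubset-≡ refl)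
       ; (inj₂ (A ,ₖ p)) → refl })

KSubset↔Fin : ∀ n k → KSubset n k ↔ Fin (n C k)
KSubset↔Fin zero zero = mk↔ₛ′ (λ _ → zero) (λ _ → [] ,ₖ refl)
  (λ { zero → refl }) (λ { ([] ,ₖ refl) → refl })
KSubset↔Fin zero (suc k) = mk↔ₛ′ (λ { ([] ,ₖ ()) }) (λ ()) (λ ()) (λ { ([] ,ₖ ()) })
KSubset↔Fin (suc n) zero =
  Fin-cong (trans (nC0≡1 n) (sym (nC0≡1 (suc n)))) ↔-∘ (KSubset↔Fin n zero ↔-∘ ↔-sym consOutside)
KSubset↔Fin (suc n) (suc k) =
  Fin-cong (nCk+nC[k+1]≡[n+1]C[k+1] n k) ↔-∘ (↔-sym +↔⊎ ↔-∘
    ((KSubset↔Fin n k ⊎-↔ KSubset↔Fin n (suc k)) ↔-∘ ↔-sym cons))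

instance
  Fin-finite : Finite (Fin n)
  Fin-finite {n} = record { card = n ; enumeration = ↔-id _ }

  KSubset-finite : Finite (KSubset n k)
  KSubset-finite {n} {k} = record { card = n C k ; enumeration = KSubset↔Fin n k }

module Spectral (R : OrderedField c ℓ₁ ℓ₂) where
  open OrderedField R hiding (sym; trans; refl; zero)
  open RawMonoidDefs +-rawMonoid using (sum) renaming (_×_ to _·_)
  open SetoidPermutation setoid using (_↭_)

  Vector : Set → Set c
  Vector V = V → Carrier

  Matrix : Set → Set c
  Matrix V = V → V → Carrier

  infix 4 _≋_

  _≋_ : Vector V → Vector V → Set ℓ₁
  x ≋ y = ∀ v → x v ≈ y v

  linComb : ∀ {d} → (Fin d → Carrier) → (Fin d → Vector V) → Vector V
  linComb a b v = sum λ i → a i * b i v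

  occurrences : Carrier → List Carrier → ℕ
  occurrences μ σ = length (filter (μ ≟_) σ)

  module _ {{_ : Finite V}} where

    infixr 8 _*ᵥ_

    _*ᵥ_ : Matrix V → Vector V → Vector V
    (M *ᵥ x) u = sum λ i → M u (element i) * x (element i)

    InEigenspace : Matrix V → Carrier → Vector V → Set ℓ₁
    InEigenspace M μ x = M *ᵥ x ≋ (λ v → μ * x v)

    record EigenspaceBasis (M : Matrix V) (μ : Carrier) (d : ℕ) : Set (c ⊔ ℓ₁) where
      field
        basis       : Fin d → Vector V
        eigen       : ∀ i → InEigenspace M μ (basis i)
        independent : ∀ a → linComb a basis ≋ (λ _ → 0#) → ∀ i → a i ≈ 0#
        spanning    : ∀ x → InEigenspace M μ x → ∃[ a ] x ≋ linComb a basis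

    -- Multiplicity is the dimension of the eigenspace; Laplacian matrices are
    -- symmetric, so over an ordered field it agrees with the multiplicity as a
    -- root of the characteristic polynomial.  For μ not an eigenvalue the
    -- eigenspace is zero, so μ must not occur in σ.
    IsSpectrum : Matrix V → List Carrier → Set (c ⊔ ℓ₁)
    IsSpectrum M σ = ∀ μ → EigenspaceBasis M μ (occurrences μ σ)

    degreeMatrix : Graph V → Matrix V
    degreeMatrix G u v = if ⌊ u ≟ⱽ v ⌋ then Graph.degree G u · 1# else 0#

    adjacencyMatrix : Graph V → Matrix V
    adjacencyMatrix G u v = if ⌊ Graph.adj? G u v ⌋ then 1# else 0#

    laplacian : Graph V → Matrix V
    laplacian G u v = degreeMatrix G u v - adjacencyMatrix G u v

    IsLaplacianSpectrum : Graph V → List Carrier → Set (c ⊔ ℓ₁)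
    IsLaplacianSpectrum G = IsSpectrum (laplacian G)

  infix 4 _⊆ₘ_

  -- Lists stand for multisets: the order of the entries is irrelevant.
  _⊆ₘ_ : List Carrier → List Carrier → Set (c ⊔ ℓ₁)
  σ ⊆ₘ τ = ∃[ ρ ] τ ↭ σ ++ ρ

{-# OPTIONS --safe #-}
module Submission where

-- For x : V(G) → R put (lift x) A = Σ_{a ∈ A} x a.  If the token move a → b turns
-- A into B, then lift x A − lift x B = x a − x b, so the token Laplacian of lift x
-- at A is the sum of x a − x b over the edges ab leaving A.  The Laplacian of x
-- summed over A has in addition the edges inside A, which cancel in pairs; hence
-- lift intertwines the two Laplacians.  It is injective: if lift x = 0, then
-- moving one token shows that x is constant, and k x = 0.  So lift embeds each
-- eigenspace of G into that of F_k(G), and multiplicities can only grow.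

open import Defs
open import Level using (Level)
open import Algebra.Bundles using (CommutativeMonoid)
open import Data.Bool using (true; false; if_then_else_)
open import Data.Bool.Properties using () renaming (_≟_ to _≟ᵇ_)
open import Data.Fin using (Fin; zero; suc; punchIn)
open import Data.Fin.Properties using (punchInᵢ≢i; any?) renaming (_≟_ to _≟ᶠ_)
open import Data.Fin.Subset using (Subset; ∣_∣; _∈_; _∉_; _⊆_; _∪_; _─_; ⁅_⁆; ∁; inside; outside) renaming (⊥ to ∅; ⊤ to full)
open import Data.Fin.Subset.Properties
open import Data.List using (List; []; _∷_)
open import Data.List.Properties using (filter-some)
open import Data.List.Relation.Unary.Any using (here)
open import Data.Nat using (ℕ; zero; suc; _≤_; _<_; _∸_; s≤s; z≤n; s≤s⁻¹)
import Data.Nat.Properties as ℕ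
open import Data.Product using (∃; ∃-syntax; Σ-syntax; _×_; _,_; proj₁; proj₂)
open import Data.Sum using (inj₁; inj₂; [_,_]′)
open import Data.Vec using ([]; _∷_; lookup; here; there; tabulate; count)
open import Data.Vec.Functional using (removeAt; insertAt)
open import Data.Vec.Functional.Properties using (insertAt-lookup; insertAt-punchIn)
open import Data.Vec.Properties using ([]=⇒lookup; lookup⇒[]=; ≡-dec)
open import Function using (_∘_; Inverse)
open import Relation.Binary.PropositionalEquality using (_≡_; _≢_; refl; sym; trans; cong; cong₂; subst; module ≡-Reasoning)
open import Relation.Nullary using (¬_; Dec; yes; no; contradiction)
open import Relation.Nullary.Decidable using (⌊_⌋; _×-dec_; ¬?; decidable-stable)

private
  variable
    c ℓ₁ ℓ₂ : Level
    n k : ℕ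
    V W : Set
    P Q : Set
    p q : Subset n
    x a b : Fin n

-- Symmetric differences and intermediate subsets.

x∈p∧x∈q⇒x∉p△q : x ∈ p → x ∈ q → x ∉ p △ q
x∈p∧x∈q⇒x∉p△q here        here        ()
x∈p∧x∈q⇒x∉p△q (there x∈p) (there x∈q) (there x∈) = x∈p∧x∈q⇒x∉p△q x∈p x∈q x∈

x∉p∧x∉q⇒x∉p△q : x ∉ p → x ∉ q → x ∉ p △ q
x∉p∧x∉q⇒x∉p△q {p = p} {q} x∉p x∉q =
  [ x∉p ∘ p─q⊆p p q , x∉q ∘ p─q⊆p q p ]′ ∘ x∈p∪q⁻ (p ─ q) (q ─ p)

x∈p∧x∉q⇒x∈p△q : x ∈ p → x ∉ q → x ∈ p △ q
x∈p∧x∉q⇒x∈p△q x∈p x∉q = x∈p∪q⁺ (inj₁ (x∈p∧x∉q⇒x∈p─q x∈p x∉q))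

x∉p∧x∈q⇒x∈p△q : x ∉ p → x ∈ q → x ∈ p △ q
x∉p∧x∈q⇒x∈p△q x∉p x∈q = x∈p∪q⁺ (inj₂ (x∈p∧x∉q⇒x∈p─q x∈q x∉p))

△-cancelˡ : (p q : Subset n) → p △ (p △ q) ≡ q
△-cancelˡ []            []            = refl
△-cancelˡ (inside  ∷ p) (inside  ∷ q) = cong (inside  ∷_) (△-cancelˡ p q)
△-cancelˡ (inside  ∷ p) (outside ∷ q) = cong (outside ∷_) (△-cancelˡ p q)
△-cancelˡ (outside ∷ p) (inside  ∷ q) = cong (inside  ∷_) (△-cancelˡ p q)
△-cancelˡ (outside ∷ p) (outside ∷ q) = cong (outside ∷_) (△-cancelˡ p q)

△-cancelʳ : (p q : Subset n) → p △ q △ q ≡ p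
△-cancelʳ []            []            = refl
△-cancelʳ (inside  ∷ p) (inside  ∷ q) = cong (inside  ∷_) (△-cancelʳ p q)
△-cancelʳ (inside  ∷ p) (outside ∷ q) = cong (inside  ∷_) (△-cancelʳ p q)
△-cancelʳ (outside ∷ p) (inside  ∷ q) = cong (outside ∷_) (△-cancelʳ p q)
△-cancelʳ (outside ∷ p) (outside ∷ q) = cong (outside ∷_) (△-cancelʳ p q)

△-identityʳ : (p : Subset n) → p △ ∅ ≡ p
△-identityʳ []            = refl
△-identityʳ (inside  ∷ p) = cong (inside  ∷_) (△-identityʳ p)
△-identityʳ (outside ∷ p) = cong (outside ∷_) (△-identityʳ p)

-- Factors a token move into removing `a` and then inserting `b`. For `a` equal to `b` the left side
-- would collapse to `p`, whence the hypothesis.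
△-⁅⁆-⁅⁆ : (p : Subset n) → a ≢ b → p △ ⁅ a ⁆ △ ⁅ b ⁆ ≡ p △ (⁅ a ⁆ ∪ ⁅ b ⁆)
△-⁅⁆-⁅⁆ {a = zero}  {zero}  p a≢b = contradiction refl a≢b
△-⁅⁆-⁅⁆ {a = zero}  {suc b} (inside  ∷ p) a≢b =
  cong (outside ∷_) (cong₂ _△_ (△-identityʳ p) (sym (∪-identityˡ ⁅ b ⁆)))
△-⁅⁆-⁅⁆ {a = zero}  {suc b} (outside ∷ p) a≢b =
  cong (inside  ∷_) (cong₂ _△_ (△-identityʳ p) (sym (∪-identityˡ ⁅ b ⁆)))
△-⁅⁆-⁅⁆ {a = suc a} {zero}  (inside  ∷ p) a≢b =
  cong (outside ∷_) (trans (△-identityʳ (p △ ⁅ a ⁆)) (cong (p △_) (sym (∪-identityʳ ⁅ a ⁆))))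
△-⁅⁆-⁅⁆ {a = suc a} {zero}  (outside ∷ p) a≢b =
  cong (inside  ∷_) (trans (△-identityʳ (p △ ⁅ a ⁆)) (cong (p △_) (sym (∪-identityʳ ⁅ a ⁆))))
△-⁅⁆-⁅⁆ {a = suc a} {suc b} (inside  ∷ p) a≢b = cong (inside  ∷_) (△-⁅⁆-⁅⁆ p (a≢b ∘ cong suc))
△-⁅⁆-⁅⁆ {a = suc a} {suc b} (outside ∷ p) a≢b = cong (outside ∷_) (△-⁅⁆-⁅⁆ p (a≢b ∘ cong suc))

-- Supplies the sets at which `lift-injective` evaluates `lift x`. The only freedom is at positions
-- in `q` but not in `p`: such a position is skipped as long as the rest of `q` still has `k`
-- elements.
subset-between : (p q : Subset n) → p ⊆ q → ∣ p ∣ ≤ k → k ≤ ∣ q ∣ →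
                 ∃[ r ] (p ⊆ r × r ⊆ q × ∣ r ∣ ≡ k)
subset-between [] [] p⊆q _ z≤n = [] , (λ x∈ → x∈) , (λ x∈ → x∈) , refl
subset-between (inside ∷ p) (outside ∷ q) p⊆q _ _ with () ← p⊆q here
subset-between (inside ∷ p) (inside ∷ q) p⊆q (s≤s p≤) (s≤s ≤q)
  with r , p⊆r , r⊆q , eq ← subset-between p q (drop-∷-⊆ p⊆q) p≤ ≤q
  = inside ∷ r , s⊆s p⊆r , s⊆s r⊆q , cong suc eq
subset-between (outside ∷ p) (outside ∷ q) p⊆q p≤ ≤q
  with r , p⊆r , r⊆q , eq ← subset-between p q (drop-∷-⊆ p⊆q) p≤ ≤q
  = outside ∷ r , s⊆s p⊆r , s⊆s r⊆q , eq
subset-between {k = k} (outside ∷ p) (inside ∷ q) p⊆q p≤ ≤q with ℕ.m≤n⇒m<n∨m≡n ≤q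
... | inj₁ (s≤s ≤q′)
  with r , p⊆r , r⊆q , eq ← subset-between p q (drop-∷-⊆ p⊆q) p≤ ≤q′
  = outside ∷ r , s⊆s p⊆r , out⊆ r⊆q , eq
-- Here `k` is the size of all that remains of the upper set, so all of it is taken.
... | inj₂ refl = inside ∷ q , p⊆q , (λ x∈ → x∈) , refl

-- Sums over subsets in a commutative monoid.

module SubsetSum {c ℓ} (M : CommutativeMonoid c ℓ) where
  open CommutativeMonoid M renaming (refl to ≈-refl; sym to ≈-sym; trans to ≈-trans; ε to 0#; _∙_ to _+_)
  open import Algebra.Properties.CommutativeMonoid.Sum M public
  open import Algebra.Properties.CommutativeSemigroup commutativeSemigroup using (x∙yz≈y∙xz)
  open import Algebra.Definitions.RawMonoid rawMonoid using () renaming (_×_ to _·_)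

  -- The generality serves two instances: `ℕ`, where summing 1 counts tokens, and the additive
  -- structure of `R`, where this becomes `lift`. This is why `subsetSum-move` avoids subtraction.
  subsetSum : Subset n → (Fin n → Carrier) → Carrier
  subsetSum A x = sum λ i → if lookup A i then x i else 0#

  subsetSum-cong : (A : Subset n) {x y : Fin n → Carrier} → (∀ i → x i ≈ y i) → subsetSum A x ≈ subsetSum A y
  subsetSum-cong A {x} {y} x≈y = sum-cong-≋ λ i → go i
    where
    go : ∀ i → (if lookup A i then x i else 0#) ≈ (if lookup A i then y i else 0#)
    go i with lookup A i
    ... | true  = x≈y i
    ... | false = ≈-refl

  subsetSum-+ : (A : Subset n) (x y : Fin n → Carrier) →
                subsetSum A (λ i → x i + y i) ≈ subsetSum A x + subsetSum A y
  subsetSum-+ A x y = ≈-trans (sum-cong-≋ term)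
    (∑-distrib-+ (λ i → if lookup A i then x i else 0#) (λ i → if lookup A i then y i else 0#))
    where
    term : ∀ i → (if lookup A i then x i + y i else 0#) ≈
                 (if lookup A i then x i else 0#) + (if lookup A i then y i else 0#)
    term i with lookup A i
    ... | true  = ≈-refl
    ... | false = ≈-sym (identityˡ 0#)

  subsetSum-const : (A : Subset n) (y : Carrier) → subsetSum A (λ _ → y) ≈ ∣ A ∣ · y
  subsetSum-const []            y = ≈-refl
  subsetSum-const (inside  ∷ A) y = ∙-congˡ (subsetSum-const A y)
  subsetSum-const (outside ∷ A) y = ≈-trans (identityˡ _) (subsetSum-const A y)

  subsetSum-insert : (A : Subset n) (x : Fin n → Carrier) → b ∉ A →
                     subsetSum (A △ ⁅ b ⁆) x ≈ x b + subsetSum A x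
  subsetSum-insert {b = zero}  (inside  ∷ A) x b∉A = contradiction here b∉A
  subsetSum-insert {b = zero}  (outside ∷ A) x b∉A =
    ∙-congˡ (≈-trans (reflexive (cong (λ B → subsetSum B (x ∘ suc)) (△-identityʳ A))) (≈-sym (identityˡ _)))
  subsetSum-insert {b = suc b} (inside  ∷ A) x b∉A =
    ≈-trans (∙-congˡ (subsetSum-insert A (x ∘ suc) (b∉A ∘ there))) (x∙yz≈y∙xz _ _ _)
  subsetSum-insert {b = suc b} (outside ∷ A) x b∉A =
    ≈-trans (∙-congˡ (subsetSum-insert A (x ∘ suc) (b∉A ∘ there))) (x∙yz≈y∙xz _ _ _)

  -- Both sides are x a + x b + the sum over A △ ⁅ a ⁆ = A ∖ {a}.
  subsetSum-move : (A : Subset n) (x : Fin n → Carrier) → a ∈ A → b ∉ A →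
                   subsetSum A x + x b ≈ subsetSum (A △ (⁅ a ⁆ ∪ ⁅ b ⁆)) x + x a
  subsetSum-move {a = a} {b} A x a∈A b∉A = ≈-trans
    (∙-congʳ (≈-trans (reflexive (cong (λ B → subsetSum B x) (sym (△-cancelʳ A ⁅ a ⁆)))) (subsetSum-insert C x a∉C)))
    (≈-sym (≈-trans
      (∙-congʳ (≈-trans (reflexive (cong (λ B → subsetSum B x) (sym (△-⁅⁆-⁅⁆ A a≢b)))) (subsetSum-insert C x b∉C)))
      (≈-trans (comm _ _) (≈-sym (≈-trans (assoc _ _ _) (∙-congˡ (comm _ _)))))))
    where
    C   = A △ ⁅ a ⁆
    a≢b : a ≢ b
    a≢b refl = b∉A a∈A
    a∉C : a ∉ C
    a∉C = x∈p∧x∈q⇒x∉p△q a∈A (x∈⁅x⁆ a)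
    b∉C : b ∉ C
    b∉C = x∉p∧x∉q⇒x∉p△q b∉A (λ b∈a → a≢b (sym (x∈⁅y⁆⇒x≡y a b∈a)))

  sum-zero : ∀ {m} (f : Fin m → Carrier) → (∀ i → f i ≈ 0#) → sum f ≈ 0#
  sum-zero {m} f f≈0 = ≈-trans (sum-cong-≋ f≈0) (sum-replicate-zero m)

  sum-single : ∀ {m} (i : Fin m) (f : Fin m → Carrier) → (∀ j → j ≢ i → f j ≈ 0#) → sum f ≈ f i
  sum-single {suc m} i f f≈0 = ≈-trans (sum-remove {i = i} f)
    (≈-trans (∙-congˡ (sum-zero (removeAt f i) λ j → f≈0 _ (punchInᵢ≢i i j))) (identityʳ _))

-- Cardinality is the sum of the constant 1 in `ℕ`, so `subsetSum-move` applies, and the common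
-- summand 1 cancels.
∣move∣ : (A : Subset n) → a ∈ A → b ∉ A → ∣ A △ (⁅ a ⁆ ∪ ⁅ b ⁆) ∣ ≡ ∣ A ∣
∣move∣ {a = a} {b} A a∈A b∉A = ℕ.+-cancelʳ-≡ 1 _ _ (begin
  ∣ A △ (⁅ a ⁆ ∪ ⁅ b ⁆) ∣ + 1                 ≡⟨ cong (_+ 1) (∣∣≡subsetSum (A △ (⁅ a ⁆ ∪ ⁅ b ⁆))) ⟩
  subsetSum (A △ (⁅ a ⁆ ∪ ⁅ b ⁆)) (λ _ → 1) + 1 ≡⟨ subsetSum-move A (λ _ → 1) a∈A b∉A ⟨
  subsetSum A (λ _ → 1) + 1                   ≡⟨ cong (_+ 1) (∣∣≡subsetSum A) ⟨
  ∣ A ∣ + 1                                   ∎)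
  where
  open SubsetSum ℕ.+-0-commutativeMonoid
  open ≡-Reasoning
  open import Data.Nat using (_+_)
  ∣∣≡subsetSum : (B : Subset n) → ∣ B ∣ ≡ subsetSum B (λ _ → 1)
  ∣∣≡subsetSum []            = refl
  ∣∣≡subsetSum (inside  ∷ B) = cong suc (∣∣≡subsetSum B)
  ∣∣≡subsetSum (outside ∷ B) = ∣∣≡subsetSum B

KSubset-≡ : {A B : KSubset n k} → subset A ≡ subset B → A ≡ B
KSubset-≡ {A = A ,ₖ p} {B = .A ,ₖ q} refl = cong (A ,ₖ_) (ℕ.≡-irrelevant p q)

-- Moving one token along an edge.

module Moves (G : Graph (Fin n)) where
  open Graph G

  -- The body of the existentials in `TokenAdj`, so that token adjacency is definitionally the
  -- existence of `a` and `b` with a `Shift`.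
  Shift : (A B : Subset n) (a b : Fin n) → Set
  Shift A B a b = a ∈ A × b ∈ B × Adj a b × A △ B ≡ ⁅ a ⁆ ∪ ⁅ b ⁆

  shift? : (A B : Subset n) (a b : Fin n) → Dec (Shift A B a b)
  shift? A B a b = a ∈? A ×-dec b ∈? B ×-dec adj? a b
                   ×-dec ≡-dec _≟ᵇ_ (A △ B) (⁅ a ⁆ ∪ ⁅ b ⁆)

  -- The same step seen from `A` alone; `shift⇒target` and `move⇒shift` recover the target set.
  Move : (A : Subset n) (a b : Fin n) → Set
  Move A a b = a ∈ A × b ∉ A × Adj a b

  move? : (A : Subset n) (a b : Fin n) → Dec (Move A a b)
  move? A a b = a ∈? A ×-dec ¬? (b ∈? A) ×-dec adj? a b

  module _ {A B : Subset n} where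

    shift⇒a∉B : Shift A B a b → a ∉ B
    shift⇒a∉B {a = a} (a∈A , _ , _ , eq) a∈B =
      x∈p∧x∈q⇒x∉p△q a∈A a∈B (subst (a ∈_) (sym eq) (x∈p∪q⁺ (inj₁ (x∈⁅x⁆ a))))

    shift⇒b∉A : Shift A B a b → b ∉ A
    shift⇒b∉A {b = b} (_ , b∈B , _ , eq) b∈A =
      x∈p∧x∈q⇒x∉p△q b∈A b∈B (subst (b ∈_) (sym eq) (x∈p∪q⁺ (inj₂ (x∈⁅x⁆ b))))

    shift⇒move : Shift A B a b → Move A a b
    shift⇒move s@(a∈A , _ , ab , _) = a∈A , shift⇒b∉A s , ab

    shift⇒target : Shift A B a b → B ≡ A △ (⁅ a ⁆ ∪ ⁅ b ⁆)
    shift⇒target (_ , _ , _ , eq) =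
      trans (sym (△-cancelˡ (A) (B))) (cong (A △_) eq)

    -- Since `a` lies in `A △ B`, it is `a′` or `b′`; but `b′` lies in `B` and `a` does not.
    -- Together with the analogue for targets, this ensures that each neighbour of `A` is counted by
    -- a single pair.
    shift-unique-source : ∀ {a b a′ b′} → Shift A B a b → Shift A B a′ b′ → a ≡ a′
    shift-unique-source {a} {b} {a′} {b′} s@(a∈A , _) s′@(_ , b′∈B , _ , eq)
      with x∈p∪q⁻ ⁅ a′ ⁆ ⁅ b′ ⁆ (subst (a ∈_) eq (x∈p∧x∉q⇒x∈p△q a∈A (shift⇒a∉B s)))
    ... | inj₁ a∈a′ = x∈⁅y⁆⇒x≡y a′ a∈a′
    ... | inj₂ a∈b′ with refl ← x∈⁅y⁆⇒x≡y b′ a∈b′ = contradiction b′∈B (shift⇒a∉B s)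

    shift-unique-target : ∀ {a b a′ b′} → Shift A B a b → Shift A B a′ b′ → b ≡ b′
    shift-unique-target {a} {b} {a′} {b′} s@(_ , b∈B , _) s′@(a′∈A , _ , _ , eq)
      with x∈p∪q⁻ ⁅ a′ ⁆ ⁅ b′ ⁆ (subst (b ∈_) eq (x∉p∧x∈q⇒x∈p△q (shift⇒b∉A s) b∈B))
    ... | inj₁ b∈a′ with refl ← x∈⁅y⁆⇒x≡y a′ b∈a′ = contradiction a′∈A (shift⇒b∉A s)
    ... | inj₂ b∈b′ = x∈⁅y⁆⇒x≡y b′ b∈b′

  move⇒shift : (A : KSubset n k) → Move (subset A) a b → ∃[ B ] Shift (subset A) (subset {k = k} B) a b
  move⇒shift {a = a} {b} (A ,ₖ ∣A∣≡k) (a∈A , b∉A , ab) =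
    (A △ (⁅ a ⁆ ∪ ⁅ b ⁆)) ,ₖ trans (∣move∣ A a∈A b∉A) ∣A∣≡k ,
    a∈A ,
    x∉p∧x∈q⇒x∈p△q b∉A (x∈p∪q⁺ (inj₂ (x∈⁅x⁆ b))) ,
    ab ,
    △-cancelˡ A (⁅ a ⁆ ∪ ⁅ b ⁆)

module _ (R : OrderedField c ℓ₁ ℓ₂) where
  open OrderedField R renaming (refl to ≈-refl; sym to ≈-sym; trans to ≈-trans) hiding (zero)
  open Spectral R
  open SubsetSum +-commutativeMonoid
  open import Algebra.Properties.Semiring.Sum semiring using (*-distribˡ-sum; *-distribʳ-sum)
  open import Algebra.Properties.Semiring.Mult semiring using (×-assoc-*; ×-congʳ) renaming (_×_ to _·_)
  open import Algebra.Properties.Ring ring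
  open import Relation.Binary.Reasoning.Setoid setoid

  -- Indicator sums and the action of the Laplacian.

  mask : Dec P → Carrier → Carrier
  mask d y = if ⌊ d ⌋ then y else 0#

  mask-yes : (d : Dec P) {y : Carrier} → P → mask d y ≈ y
  mask-yes (yes _) p = ≈-refl
  mask-yes (no ¬p) p = contradiction p ¬p

  mask-no : (d : Dec P) {y : Carrier} → ¬ P → mask d y ≈ 0#
  mask-no (yes p) ¬p = contradiction p ¬p
  mask-no (no _)  ¬p = ≈-refl

  mask-1-* : (d : Dec P) (y : Carrier) → mask d 1# * y ≈ mask d y
  mask-1-* (yes _) y = *-identityˡ y
  mask-1-* (no _)  y = zeroˡ y

  -- To be read with `a ∈ A`, `b ∈ A` and adjacency for the three conditions: an edge starting in
  -- `A` either leaves `A` or stays inside it.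
  mask-split : ∀ {S} (P? : Dec P) (Q? : Dec Q) (S? : Dec S) {y : Carrier} →
               mask P? (mask S? y) ≈ mask (P? ×-dec ¬? Q? ×-dec S?) y + mask (P? ×-dec Q? ×-dec S?) y
  mask-split P?@(no ¬p) Q? S? {y} = ≈-sym (≈-trans
    (+-cong (mask-no (P? ×-dec ¬? Q? ×-dec S?) {y} (¬p ∘ proj₁)) (mask-no (P? ×-dec Q? ×-dec S?) {y} (¬p ∘ proj₁)))
    (+-identityˡ 0#))
  mask-split P?@(yes _) Q? S?@(no ¬s) {y} = ≈-sym (≈-trans
    (+-cong (mask-no (P? ×-dec ¬? Q? ×-dec S?) {y} (¬s ∘ proj₂ ∘ proj₂)) (mask-no (P? ×-dec Q? ×-dec S?) {y} (¬s ∘ proj₂ ∘ proj₂)))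
    (+-identityˡ 0#))
  mask-split P?@(yes p) Q?@(yes q) S?@(yes s) {y} = ≈-sym (≈-trans
    (+-cong (mask-no (P? ×-dec ¬? Q? ×-dec S?) {y} (λ (_ , ¬q , _) → ¬q q)) (mask-yes (P? ×-dec Q? ×-dec S?) {y} (p , q , s)))
    (+-identityˡ _))
  mask-split P?@(yes p) Q?@(no ¬q) S?@(yes s) {y} = ≈-sym (≈-trans
    (+-cong (mask-yes (P? ×-dec ¬? Q? ×-dec S?) {y} (p , ¬q , s)) (mask-no (P? ×-dec Q? ×-dec S?) {y} (λ (_ , q , _) → ¬q q)))
    (+-identityʳ _))

  mask-∈ : (A : Subset n) (i : Fin n) (y : Carrier) → (if lookup A i then y else 0#) ≈ mask (i ∈? A) y
  mask-∈ A i y with lookup A i in eq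
  ... | true  = ≈-sym (mask-yes (i ∈? A) (lookup⇒[]= i A eq))
  ... | false = ≈-sym (mask-no (i ∈? A) λ i∈A → contradiction (trans (sym eq) ([]=⇒lookup i∈A)) λ ())

  mask-sum : (d : Dec P) (f : Fin n → Carrier) → mask d (sum f) ≈ sum λ i → mask d (f i)
  mask-sum     (yes _) f = ≈-refl
  mask-sum {n = n} (no _) f = ≈-sym (sum-replicate-zero n)

  module _ {{_ : Finite V}} where

    ∑ : (V → Carrier) → Carrier
    ∑ f = sum (λ i → f (element i))

    ∑-single : (v : V) (f : V → Carrier) → (∀ w → w ≢ v → f w ≈ 0#) → ∑ f ≈ f v
    ∑-single v f f≈0 = ≈-trans
      (sum-single (Inverse.to enumeration v) (f ∘ element) λ j j≢ →
        f≈0 (element j) λ e → j≢ (trans (sym (Inverse.strictlyInverseˡ (enumeration {V}) j)) (cong (Inverse.to (enumeration {V})) e)))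
      (reflexive (cong f (Inverse.strictlyInverseʳ enumeration v)))

    ∑-cong : {f g : V → Carrier} → (∀ v → f v ≈ g v) → ∑ f ≈ ∑ g
    ∑-cong f≈g = sum-cong-≋ (f≈g ∘ element)

    ∑-+ : (f g : V → Carrier) → ∑ (λ v → f v + g v) ≈ ∑ f + ∑ g
    ∑-+ f g = ∑-distrib-+ (f ∘ element) (g ∘ element)

    -- Trades a condition for a sum over its unique witness; this is how token neighbours and pairs
    -- of vertices are exchanged. Letting `f` depend on the witness allows the summand to be
    -- rewritten at the same time.
    mask-∑ : {S : V → Set} (Q? : Dec Q) (S? : ∀ v → Dec (S v)) →
             (Q → ∃ S) → (∀ {v} → S v → Q) → (∀ {v w} → S v → S w → v ≡ w) →
             (y : Carrier) (f : V → Carrier) → (∀ {v} → S v → y ≈ f v) →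
             mask Q? y ≈ ∑ λ v → mask (S? v) (f v)
    mask-∑ (yes q) S? to from unique y f y≈f with v , sv ← to q = ≈-sym (≈-trans
      (∑-single v (λ v → mask (S? v) (f v)) λ w w≢v → mask-no (S? w) λ sw → w≢v (unique sw sv))
      (≈-trans (mask-yes (S? v) sv) (≈-sym (y≈f sv))))
    mask-∑ (no ¬q) S? to from unique y f y≈f =
      ≈-sym (sum-zero (λ i → mask (S? (element i)) (f (element i))) λ i → mask-no (S? (element i)) (¬q ∘ from))

    count-· : ∀ {S : V → Set} {m} (S? : ∀ v → Dec (S v)) (f : Fin m → V) →
              count S? (tabulate f) · 1# ≈ sum λ i → mask (S? (f i)) 1#
    count-· {m = zero}  S? f = ≈-refl
    count-· {m = suc m} S? f with S? (f zero)
    ... | yes _ = +-congˡ (count-· S? (f ∘ suc))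
    ... | no _  = ≈-trans (count-· S? (f ∘ suc)) (≈-sym (+-identityˡ _))

    -- The degree is a row sum of the adjacency matrix by `count-·`, so the diagonal entry
    -- contributes one copy of `x u` for every neighbour.
    laplacian-*ᵥ : (G : Graph V) (x : Vector V) (u : V) →
                   (laplacian G *ᵥ x) u ≈ ∑ λ v → mask (Graph.adj? G u v) (x u - x v)
    laplacian-*ᵥ G x u = begin
      ∑ (λ v → (D v - A v) * x v)                        ≈⟨ ∑-cong split ⟩
      ∑ (λ v → D v * x v + A v * - x v)                  ≈⟨ ∑-+ (λ v → D v * x v) (λ v → A v * - x v) ⟩
      ∑ (λ v → D v * x v) + ∑ (λ v → A v * - x v)        ≈⟨ +-congʳ diagonal ⟩
      ∑ (λ v → A v * x u) + ∑ (λ v → A v * - x v)        ≈⟨ ∑-+ (λ v → A v * x u) (λ v → A v * - x v) ⟨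
      ∑ (λ v → A v * x u + A v * - x v)                  ≈⟨ ∑-cong merge ⟩
      ∑ (λ v → mask (Graph.adj? G u v) (x u - x v))      ∎
      where
      D A : V → Carrier
      D = degreeMatrix G u
      A = adjacencyMatrix G u
      split : ∀ v → (D v - A v) * x v ≈ D v * x v + A v * - x v
      split v = ≈-trans ([y-z]x≈yx-zx _ _ _) (+-congˡ (-‿distribʳ-* _ _))
      merge : ∀ v → A v * x u + A v * - x v ≈ mask (Graph.adj? G u v) (x u - x v)
      merge v = ≈-trans (≈-sym (distribˡ _ _ _)) (mask-1-* (Graph.adj? G u v) _)
      diagonal : ∑ (λ v → D v * x v) ≈ ∑ (λ v → A v * x u)
      diagonal = begin
        ∑ (λ v → D v * x v)                  ≈⟨ ∑-single u (λ v → D v * x v) (λ v v≢u →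
                                                  ≈-trans (*-congʳ (mask-no (u ≟ⱽ v) (v≢u ∘ sym))) (zeroˡ _)) ⟩
        D u * x u                            ≈⟨ *-congʳ (mask-yes (u ≟ⱽ u) refl) ⟩
        (Graph.degree G u · 1#) * x u        ≈⟨ *-congʳ (count-· (Graph.adj? G u) element) ⟩
        ∑ A * x u                            ≈⟨ *-distribʳ-sum (x u) (A ∘ element) ⟩
        ∑ (λ v → A v * x u)                  ∎

  -- Adding the double sum to its transpose cancels termwise. This controls only twice the sum;
  -- halving requires characteristic zero, established below.
  sum+sum-antisym-zero : ∀ {m} (f : Fin m → Fin m → Carrier) → (∀ i j → f i j + f j i ≈ 0#) →
                sum (λ i → sum (f i)) + sum (λ i → sum (f i)) ≈ 0#
  sum+sum-antisym-zero f anti = begin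
    sum (λ i → sum (f i)) + sum (λ i → sum (f i))         ≈⟨ +-congˡ (∑-comm f) ⟩
    sum (λ i → sum (f i)) + sum (λ j → sum (λ i → f i j)) ≈⟨ ∑-distrib-+ (λ i → sum (f i)) (λ j → sum (λ i → f i j)) ⟨
    sum (λ i → sum (f i) + sum (λ j → f j i))             ≈⟨ sum-zero (λ i → sum (f i) + sum (λ j → f j i)) (λ i →
                                                               ≈-trans (≈-sym (∑-distrib-+ (f i) (λ j → f j i)))
                                                                       (sum-zero (λ j → f i j + f j i) (anti i))) ⟩
    0#                                                    ∎

  -- Characteristic zero from the order.

  private
    open import Relation.Binary using (IsDecTotalOrder)
    module ≼ = IsDecTotalOrder isDecTotalOrder

  -- If instead `1# ≼ 0#`, then `- 1#` is nonnegative, and so is its square, which is `1#`.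
  0≼1 : 0# ≼ 1#
  0≼1 with ≼.total 0# 1#
  ... | inj₁ 0≼1 = 0≼1
  ... | inj₂ 1≼0 = ≼.≤-respʳ-≈ (≈-trans (≈-sym (-‿distribˡ-* 1# (- 1#))) (≈-trans (-‿cong (*-identityˡ _)) (-‿involutive 1#))) (*-nonneg 0≼-1 0≼-1)
    where
    0≼-1 : 0# ≼ (- 1#)
    0≼-1 = ≼.≤-respˡ-≈ (-‿inverseʳ 1#) (≼.≤-respʳ-≈ (+-identityˡ _) (+-monoˡ-≼ (- 1#) 1≼0))

  0≼n·1 : ∀ n → 0# ≼ (n · 1#)
  0≼n·1 zero    = ≼.refl
  0≼n·1 (suc n) = ≼.trans 0≼1 (≼.≤-respˡ-≈ (+-identityˡ 1#) (≼.≤-respʳ-≈ (+-comm _ _) (+-monoˡ-≼ 1# (0≼n·1 n))))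

  -- Since `1# ≼ suc n · 1#`, a vanishing multiple would give `1# ≼ 0#`, and antisymmetry would
  -- identify `0#` with `1#`.
  suc·1≉0 : ∀ n → ¬ (suc n · 1# ≈ 0#)
  suc·1≉0 n eq = 0≉1 (≼.antisym 0≼1 (≼.≤-respʳ-≈ eq
    (≼.≤-respˡ-≈ (+-identityˡ 1#) (≼.≤-respʳ-≈ (+-comm _ _) (+-monoˡ-≼ 1# (0≼n·1 n))))))

  *-cancelˡ-0 : ∀ {x y} → ¬ (x ≈ 0#) → x * y ≈ 0# → y ≈ 0#
  *-cancelˡ-0 {x} {y} x≉0 xy≈0 with x⁻¹ , xx⁻¹≈1 ← inverse x x≉0 = begin
    y              ≈⟨ *-identityˡ y ⟨
    1# * y         ≈⟨ *-congʳ (≈-trans (*-comm x⁻¹ x) xx⁻¹≈1) ⟨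
    x⁻¹ * x * y    ≈⟨ *-assoc x⁻¹ x y ⟩
    x⁻¹ * (x * y)  ≈⟨ *-congˡ xy≈0 ⟩
    x⁻¹ * 0#       ≈⟨ zeroʳ x⁻¹ ⟩
    0#             ∎

  -- Applied with the factor 2 in `sum-antisym-zero` and with the number of tokens in
  -- `lift-injective`.
  ·-cancel-0 : ∀ n {y} → suc n · y ≈ 0# → y ≈ 0#
  ·-cancel-0 n {y} eq = *-cancelˡ-0 (suc·1≉0 n) (≈-trans (×-assoc-* (suc n) 1# y)
    (≈-trans (×-congʳ (suc n) (*-identityˡ y)) eq))

  sum-antisym-zero : ∀ {m} (f : Fin m → Fin m → Carrier) → (∀ i j → f i j + f j i ≈ 0#) →
                     sum (λ i → sum (f i)) ≈ 0#
  sum-antisym-zero f anti = ·-cancel-0 1 (≈-trans (+-congˡ (+-identityʳ _)) (sum+sum-antisym-zero f anti))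

  -- Turns the subtraction-free `subsetSum-move` into the difference needed by `lift-shift`.
  differences : ∀ {x y z w} → x + y ≈ z + w → x - z ≈ w - y
  differences {x} {y} {z} {w} eq = begin
    x - z                ≈⟨ +-identityʳ _ ⟨
    x - z + 0#           ≈⟨ +-congˡ (-‿inverseʳ y) ⟨
    x - z + (y - y)      ≈⟨ interchange x (- z) y (- y) ⟩
    x + y + (- z - y)    ≈⟨ +-congʳ eq ⟩
    z + w + (- z - y)    ≈⟨ interchange z w (- z) (- y) ⟩
    (z - z) + (w - y)    ≈⟨ +-congʳ (-‿inverseʳ z) ⟩
    0# + (w - y)         ≈⟨ +-identityˡ _ ⟩
    w - y                ∎
    where open import Algebra.Properties.CommutativeSemigroup +-commutativeSemigroup using (interchange)

  -- The lift: intertwining, injectivity, linearity.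

  lift : Vector (Fin n) → Vector (KSubset n k)
  lift x A = subsetSum (subset A) x

  module _ (G : Graph (Fin n)) where
    open Graph G
    open Moves G

    lift-shift : (x : Vector (Fin n)) {A B : KSubset n k} → Shift (subset A) (subset B) a b → lift x A - lift x B ≈ x a - x b
    lift-shift {a = a} {b} x {A} s@(a∈A , _) = differences (≈-trans
      (subsetSum-move (subset A) x a∈A (shift⇒b∉A s))
      (+-congʳ (reflexive (cong (λ B → subsetSum B x) (sym (shift⇒target s))))))

    lift-laplacian : (x : Vector (Fin n)) → laplacian (tokenGraph k G) *ᵥ lift x ≋ lift (laplacian G *ᵥ x)
    lift-laplacian {k} x A = begin
      (laplacian (tokenGraph k G) *ᵥ lift x) A
        ≈⟨ laplacian-*ᵥ (tokenGraph k G) (lift x) A ⟩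
      ∑ {V = KSubset n k} (λ B → mask (Graph.adj? (tokenGraph k G) A B) (lift x A - lift x B))
        ≈⟨ ∑-cong shifts ⟩
      ∑ {V = KSubset n k} (λ B → sum λ a → sum λ b → mask (shift? (subset A) (subset B) a b) (z a b))
        ≈⟨ ∑-comm {m = card {V = KSubset n k}} (λ i a → sum λ b → mask (shift? (subset A) (subset (element i)) a b) (z a b)) ⟩
      sum (λ a → ∑ {V = KSubset n k} λ B → sum λ b → mask (shift? (subset A) (subset B) a b) (z a b))
        ≈⟨ sum-cong-≋ (λ a → ∑-comm {m = card {V = KSubset n k}} (λ i b → mask (shift? (subset A) (subset (element i)) a b) (z a b))) ⟩
      sum (λ a → sum λ b → ∑ {V = KSubset n k} λ B → mask (shift? (subset A) (subset B) a b) (z a b))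
        ≈⟨ sum-cong-≋ (λ a → sum-cong-≋ λ b → moves a b) ⟩
      sum (λ a → sum λ b → mask (move? (subset A) a b) (z a b))
        -- The zero to be added is the sum of `inner`, which completes the moves out of `A` to all
        -- edges starting in `A`.
        ≈⟨ +-identityʳ _ ⟨
      sum (λ a → sum λ b → mask (move? (subset A) a b) (z a b)) + 0#
        ≈⟨ +-congˡ (sum-antisym-zero inner inner-anti) ⟨
      sum (λ a → sum λ b → mask (move? (subset A) a b) (z a b)) + sum (λ a → sum (inner a))
        ≈⟨ ∑-distrib-+ (λ a → sum λ b → mask (move? (subset A) a b) (z a b)) (λ a → sum (inner a)) ⟨
      sum (λ a → sum (λ b → mask (move? (subset A) a b) (z a b)) + sum (inner a))
        ≈⟨ sum-cong-≋ (λ a → ∑-distrib-+ (λ b → mask (move? (subset A) a b) (z a b)) (inner a)) ⟨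
      sum (λ a → sum λ b → mask (move? (subset A) a b) (z a b) + inner a b)
        ≈⟨ sum-cong-≋ (λ a → sum-cong-≋ λ b → split a b) ⟨
      sum (λ a → sum λ b → mask (a ∈? subset A) (mask (adj? a b) (z a b)))
        ≈⟨ sum-cong-≋ (λ a → mask-sum (a ∈? subset A) (λ b → mask (adj? a b) (z a b))) ⟨
      sum (λ a → mask (a ∈? subset A) (sum λ b → mask (adj? a b) (z a b)))
        ≈⟨ sum-cong-≋ (λ a → mask-∈ (subset A) a _) ⟨
      subsetSum (subset A) (λ a → sum λ b → mask (adj? a b) (z a b))
        ≈⟨ subsetSum-cong (subset A) (laplacian-*ᵥ G x) ⟨
      lift (laplacian G *ᵥ x) A ∎
      where
      z : Fin n → Fin n → Carrier
      z a b = x a - x b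

      within? : ∀ a b → Dec (a ∈ subset A × b ∈ subset A × Adj a b)
      within? a b = a ∈? subset A ×-dec b ∈? subset A ×-dec adj? a b

      inner : Fin n → Fin n → Carrier
      inner a b = mask (within? a b) (z a b)

      inner-anti : ∀ a b → inner a b + inner b a ≈ 0#
      inner-anti a b with within? a b
      ... | yes (a∈ , b∈ , ab) = ≈-trans (+-congˡ (mask-yes (within? b a) (b∈ , a∈ , symm ab)))
              (≈-trans (+-congʳ (≈-sym (⁻¹-anti-homo‿- (x b) (x a)))) (-‿inverseˡ _))
      ... | no ¬w = ≈-trans (+-identityˡ _) (mask-no (within? b a) λ (b∈ , a∈ , ba) → ¬w (a∈ , b∈ , symm ba))

      split : ∀ a b → mask (a ∈? subset A) (mask (adj? a b) (z a b)) ≈ mask (move? (subset A) a b) (z a b) + inner a b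
      split a b = mask-split (a ∈? subset A) (b ∈? subset A) (adj? a b)

      moves : ∀ a b → ∑ {V = KSubset n k} (λ B → mask (shift? (subset A) (subset B) a b) (z a b)) ≈ mask (move? (subset A) a b) (z a b)
      -- With `a` and `b` fixed, the target is forced to be `A △ (⁅ a ⁆ ∪ ⁅ b ⁆)`, so the sum over
      -- `B` has at most one nonzero term.
      moves a b = ≈-sym (mask-∑ (move? (subset A) a b) (λ B → shift? (subset A) (subset B) a b) (move⇒shift A) shift⇒move
        (λ s s′ → KSubset-≡ (trans (shift⇒target s) (sym (shift⇒target s′)))) (z a b) (λ _ → z a b) λ _ → ≈-refl)

      shifts : ∀ B → mask (Graph.adj? (tokenGraph k G) A B) (lift x A - lift x B) ≈
                     sum λ a → sum λ b → mask (shift? (subset A) (subset B) a b) (z a b)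
      shifts B = ≈-trans
        -- Adjacency is resolved first into its unique source, then into its unique target; at the
        -- second stage `lift-shift` replaces the value by `z a b`.
        (mask-∑ (Graph.adj? (tokenGraph k G) A B) (λ a → any? (shift? (subset A) (subset B) a)) (λ t → t) (λ {a} t → a , t)
          (λ (_ , s) (_ , s′) → shift-unique-source s s′) _ (λ _ → lift x A - lift x B) λ _ → ≈-refl)
        (sum-cong-≋ λ a → mask-∑ (any? (shift? (subset A) (subset B) a)) (shift? (subset A) (subset B) a) (λ t → t) (λ {b} s → b , s)
          shift-unique-target _ (z a) (lift-shift x {A} {B}))

  -- The hypothesis `k ≡ n → n ≡ 1` excludes a real failure: for `k ≡ n` the only value of `lift x`
  -- is the total sum of `x`, which vanishes at some nonzero vectors as soon as `n` exceeds 1.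
  lift-injective : 1 ≤ k → k ≤ n → (k ≡ n → n ≡ 1) → (x : Vector (Fin n)) →
                   lift {k = k} x ≋ (λ _ → 0#) → ∀ i → x i ≈ 0#
  lift-injective {k = suc k} {n} 1≤k k≤n k≡n⇒n≡1 x lift≈0 i
    -- As `x` is constant, any set of the right size will do.
    with A , _ , _ , ∣A∣≡k ← subset-between ∅ full ⊥⊆
           (ℕ.≤-trans (ℕ.≤-reflexive (∣⊥∣≡0 n)) z≤n) (ℕ.≤-trans k≤n (ℕ.≤-reflexive (sym (∣⊤∣≡n n))))
    = ·-cancel-0 k (begin
      suc k · x i                 ≈⟨ reflexive (cong (_· x i) ∣A∣≡k) ⟨
      ∣ A ∣ · x i                 ≈⟨ subsetSum-const A (x i) ⟨
      subsetSum A (λ _ → x i)     ≈⟨ subsetSum-cong A constant ⟩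
      subsetSum A x               ≈⟨ lift≈0 (A ,ₖ ∣A∣≡k) ⟩
      0#                          ∎)
    where
    n≢1 : ∀ {i j : Fin n} → i ≢ j → n ≢ 1
    n≢1 {zero} {zero} i≢j refl = i≢j refl
    exchange : ∀ {j} → i ≢ j → x i ≈ x j
    exchange {j} i≢j
      -- A set of tokens containing `i` and avoiding `j` needs at most `n ∸ 1` tokens. Using all `n`
      -- would force `n ≡ 1`, which `i≢j` contradicts.
      with A , i∈ , ⊆∁j , ∣A∣≡k ← subset-between ⁅ i ⁆ (∁ ⁅ j ⁆)
             (λ l∈i → x∉p⇒x∈∁p λ l∈j → i≢j (trans (sym (x∈⁅y⁆⇒x≡y i l∈i)) (x∈⁅y⁆⇒x≡y j l∈j)))
             (ℕ.≤-trans (ℕ.≤-reflexive (∣⁅x⁆∣≡1 i)) 1≤k)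
             (subst (suc k ≤_) (sym (trans (∣∁p∣≡n∸∣p∣ ⁅ j ⁆) (cong (n ∸_) (∣⁅x⁆∣≡1 j))))
                    (ℕ.<⇒≤pred (ℕ.≤∧≢⇒< k≤n (n≢1 i≢j ∘ k≡n⇒n≡1))))
      = ≈-sym (begin
        x j              ≈⟨ +-identityˡ _ ⟨
        0# + x j         ≈⟨ +-congʳ (lift≈0 (A ,ₖ ∣A∣≡k)) ⟨
        subsetSum A x + x j  ≈⟨ subsetSum-move A x i∈A j∉A ⟩
        subsetSum (A △ (⁅ i ⁆ ∪ ⁅ j ⁆)) x + x i
                         ≈⟨ +-congʳ (lift≈0 ((A △ (⁅ i ⁆ ∪ ⁅ j ⁆)) ,ₖ trans (∣move∣ A i∈A j∉A) ∣A∣≡k)) ⟩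
        0# + x i         ≈⟨ +-identityˡ _ ⟩
        x i              ∎)
      where
      i∈A = i∈ (x∈⁅x⁆ i)
      j∉A : j ∉ A
      j∉A j∈A = x∈∁p⇒x∉p (⊆∁j j∈A) (x∈⁅x⁆ j)
    constant : ∀ j → x i ≈ x j
    constant j with i ≟ᶠ j
    ... | yes refl = ≈-refl
    ... | no i≢j   = exchange i≢j

  lift-cong : {x y : Vector (Fin n)} → x ≋ y → lift {k = k} x ≋ lift y
  lift-cong x≋y A = subsetSum-cong (subset A) x≋y

  lift-scale : (μ : Carrier) (x : Vector (Fin n)) → lift {k = k} (λ v → μ * x v) ≋ (λ A → μ * lift x A)
  lift-scale μ x A = ≈-sym (≈-trans (*-distribˡ-sum μ (λ i → if lookup (subset A) i then x i else 0#)) (sum-cong-≋ term))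
    where
    term : ∀ i → μ * (if lookup (subset A) i then x i else 0#) ≈ (if lookup (subset A) i then μ * x i else 0#)
    term i with lookup (subset A) i
    ... | true  = ≈-refl
    ... | false = zeroʳ μ

  lift-linComb : ∀ {d} (a : Fin d → Carrier) (b : Fin d → Vector (Fin n)) →
                 lift {k = k} (linComb a b) ≋ linComb a (λ i → lift (b i))
  -- The empty combination is `0#`, written as `0# * 0#` to bring it under `lift-scale`.
  lift-linComb {d = zero}  a b A = ≈-trans (lift-cong (λ _ → ≈-sym (zeroˡ 0#)) A)
    (≈-trans (lift-scale 0# (λ _ → 0#) A) (zeroˡ _))
  lift-linComb {d = suc d} a b A = begin
    lift (linComb a b) A
      ≈⟨ subsetSum-+ (subset A) (λ v → a zero * b zero v) (linComb (a ∘ suc) (b ∘ suc)) ⟩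
    lift (λ v → a zero * b zero v) A + lift (linComb (a ∘ suc) (b ∘ suc)) A
      ≈⟨ +-cong (lift-scale (a zero) (b zero) A) (lift-linComb (a ∘ suc) (b ∘ suc) A) ⟩
    linComb a (λ i → lift (b i)) A ∎

  lift-eigen : (G : Graph (Fin n)) {μ : Carrier} {x : Vector (Fin n)} →
               InEigenspace (laplacian G) μ x → InEigenspace (laplacian (tokenGraph k G)) μ (lift x)
  lift-eigen G {μ} {x} Lx≋μx A = begin
    (laplacian (tokenGraph _ G) *ᵥ lift x) A  ≈⟨ lift-laplacian G x A ⟩
    lift (laplacian G *ᵥ x) A                 ≈⟨ lift-cong Lx≋μx A ⟩
    lift (λ v → μ * x v) A                    ≈⟨ lift-scale μ x A ⟩
    μ * lift x A                              ∎

  -- Linear systems and comparison of dimensions.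

  -- One step of fraction-free Gaussian elimination with pivot π: the right-hand
  -- side is the reduced equation, and - sum (γ i * β i) the unknown of the pivot row.
  eliminate : ∀ {m} (π y : Carrier) (γ α β : Fin m → Carrier) →
              - sum (λ i → γ i * β i) * y + sum (λ i → π * γ i * α i) ≈ sum (λ i → γ i * (π * α i - β i * y))
  eliminate π y γ α β = begin
    - sum (λ i → γ i * β i) * y + sum (λ i → π * γ i * α i)
      ≈⟨ +-comm _ _ ⟩
    sum (λ i → π * γ i * α i) + - sum (λ i → γ i * β i) * y
      ≈⟨ +-congˡ (≈-trans (≈-sym (-‿distribˡ-* _ _)) (-‿distribʳ-* _ _)) ⟩
    sum (λ i → π * γ i * α i) + sum (λ i → γ i * β i) * - y
      ≈⟨ +-congˡ (*-distribʳ-sum (- y) (λ i → γ i * β i)) ⟩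
    sum (λ i → π * γ i * α i) + sum (λ i → γ i * β i * - y)
      ≈⟨ ∑-distrib-+ (λ i → π * γ i * α i) (λ i → γ i * β i * - y) ⟨
    sum (λ i → π * γ i * α i + γ i * β i * - y)
      ≈⟨ sum-cong-≋ term ⟨
    sum (λ i → γ i * (π * α i - β i * y)) ∎
    where
    term : ∀ i → γ i * (π * α i - β i * y) ≈ π * γ i * α i + γ i * β i * - y
    term i = ≈-trans (distribˡ _ _ _) (+-cong
      (≈-trans (≈-sym (*-assoc _ _ _)) (*-congʳ (*-comm _ _)))
      (≈-trans (*-congˡ (-‿distribʳ-* _ _)) (≈-sym (*-assoc _ _ _))))

  -- Induction on the number of equations; `A i j` is the coefficient of unknown `i` in equation
  -- `j`. If equation `zero` has only zero coefficients, it holds for every `c` and is dropped;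
  -- otherwise it serves to eliminate one unknown.
  homogeneous-system : ∀ m {d} → m < d → (A : Fin d → Fin m → Carrier) →
    Σ[ c ∈ (Fin d → Carrier) ] (∃[ i ] ¬ (c i ≈ 0#)) × (∀ j → sum (λ i → c i * A i j) ≈ 0#)
  homogeneous-system zero    {suc d} _   A = (λ _ → 1#) , (zero , 0≉1 ∘ ≈-sym) , λ ()
  homogeneous-system (suc m) {suc d} (s≤s m<d) A with any? (λ i → ¬? (A i zero ≟ 0#))
  ... | no no-pivot
    with c , c≉0 , Ac≈0 ← homogeneous-system m (ℕ.m<n⇒m<1+n m<d) (λ i j → A i (suc j))
    = c , c≉0 , λ where
        zero    → sum-zero (λ i → c i * A i zero) λ i → ≈-trans
                    (*-congˡ (decidable-stable (A i zero ≟ 0#) λ Ai0≉0 → no-pivot (i , Ai0≉0))) (zeroʳ _)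
        (suc j) → Ac≈0 j
  ... | yes (p , π≉0)
    with γ , (i , γi≉0) , A′γ≈0 ← homogeneous-system m m<d
           (λ i j → A p zero * A (punchIn p i) (suc j) - A (punchIn p i) zero * A p (suc j))
    = coeffs , (punchIn p i , ci≉0) , λ where
        -- In the pivot equation the two products in each reduced coefficient agree by
        -- commutativity.
        zero    → ≈-trans (reduce zero) (sum-zero _ λ i → ≈-trans
                    (*-congˡ (≈-trans (+-congʳ (*-comm _ _)) (-‿inverseʳ _))) (zeroʳ (γ i)))
        (suc j) → ≈-trans (reduce (suc j)) (A′γ≈0 j)
    where
    π = A p zero
    S = sum (λ i → γ i * A (punchIn p i) zero)
    -- The value at `p` solves the pivot equation after the other unknowns are scaled by `π` to
    -- avoid division; as `π` is nonzero, the solution stays nontrivial.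
    coeffs = insertAt (λ i → π * γ i) p (- S)
    ci≉0 : ¬ (coeffs (punchIn p i) ≈ 0#)
    ci≉0 ci≈0 = γi≉0 (*-cancelˡ-0 π≉0
      (≈-trans (reflexive (sym (insertAt-punchIn (λ i → π * γ i) p (- S) i))) ci≈0))
    reduce : ∀ j → sum (λ i → coeffs i * A i j) ≈
                   sum (λ i → γ i * (π * A (punchIn p i) j - A (punchIn p i) zero * A p j))
    reduce j = begin
      sum (λ i → coeffs i * A i j)
        ≈⟨ sum-remove {i = p} (λ i → coeffs i * A i j) ⟩
      coeffs p * A p j + sum (λ i → coeffs (punchIn p i) * A (punchIn p i) j)
        ≈⟨ +-cong (*-congʳ (reflexive (insertAt-lookup (λ i → π * γ i) p (- S))))
                  (sum-cong-≋ λ i → *-congʳ (reflexive (insertAt-punchIn (λ i → π * γ i) p (- S) i))) ⟩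
      - S * A p j + sum (λ i → π * γ i * A (punchIn p i) j)
        ≈⟨ eliminate π (A p j) γ (λ i → A (punchIn p i) j) (λ i → A (punchIn p i) zero) ⟩
      sum (λ i → γ i * (π * A (punchIn p i) j - A (punchIn p i) zero * A p j)) ∎

  linComb-linComb : ∀ {d e} (c : Fin d → Carrier) (A : Fin d → Fin e → Carrier) (β : Fin e → Vector V) →
                    linComb c (λ i → linComb (A i) β) ≋ linComb (λ j → sum λ i → c i * A i j) β
  linComb-linComb {d = d} {e} c A β v = begin
    sum (λ i → c i * sum (λ j → A i j * β j v))
      ≈⟨ sum-cong-≋ (λ i → *-distribˡ-sum (c i) (λ j → A i j * β j v)) ⟩
    sum (λ i → sum λ j → c i * (A i j * β j v))
      ≈⟨ ∑-comm (λ i j → c i * (A i j * β j v)) ⟩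
    sum (λ j → sum λ i → c i * (A i j * β j v))
      ≈⟨ sum-cong-≋ (λ j → sum-cong-≋ λ i → *-assoc (c i) (A i j) (β j v)) ⟨
    sum (λ j → sum λ i → c i * A i j * β j v)
      ≈⟨ sum-cong-≋ (λ j → *-distribʳ-sum (β j v) (λ i → c i * A i j)) ⟨
    sum (λ j → sum (λ i → c i * A i j) * β j v) ∎

  -- If `e` were less than `d`, the coordinates of the images `f (B.basis i)` would satisfy a
  -- nontrivial linear relation by `homogeneous-system`. Injectivity pulls it back to the basis
  -- itself, against independence.
  eigenspace-dimension-≤ : {{_ : Finite V}} {{_ : Finite W}} {M : Matrix V} {N : Matrix W} {μ : Carrier}
    (f : Vector V → Vector W) →
    (∀ {d} (a : Fin d → Carrier) b → f (linComb a b) ≋ linComb a (f ∘ b)) →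
    (∀ x → f x ≋ (λ _ → 0#) → x ≋ (λ _ → 0#)) →
    (∀ {x} → InEigenspace M μ x → InEigenspace N μ (f x)) →
    ∀ {d e} → EigenspaceBasis M μ d → EigenspaceBasis N μ e → d ≤ e
  eigenspace-dimension-≤ f f-linComb f-injective f-eigen {d} {e} B C = ℕ.≮⇒≥ λ e<d →
    let c , (i , ci≉0) , Ac≈0 = homogeneous-system e e<d A
    in ci≉0 (B.independent c (f-injective _ (λ w → begin
      f (linComb c B.basis) w                              ≈⟨ f-linComb c B.basis w ⟩
      linComb c (f ∘ B.basis) w                            ≈⟨ sum-cong-≋ (λ i → *-congˡ (proj₂ (coordinates i) w)) ⟩
      linComb c (λ i → linComb (A i) C.basis) w            ≈⟨ linComb-linComb c A C.basis w ⟩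
      linComb (λ j → sum λ i → c i * A i j) C.basis w      ≈⟨ sum-zero _ (λ j → ≈-trans (*-congʳ (Ac≈0 j)) (zeroˡ _)) ⟩
      0#                                                   ∎)) i)
    where
    module B = EigenspaceBasis B
    module C = EigenspaceBasis C
    coordinates : ∀ i → ∃[ a ] f (B.basis i) ≋ linComb a C.basis
    coordinates i = C.spanning (f (B.basis i)) (f-eigen (B.eigen i))
    A : Fin d → Fin e → Carrier
    A i = proj₁ (coordinates i)

  -- From multiplicities to multiset containment.

  open import Data.List.Relation.Binary.Permutation.Setoid setoid using (_↭_; prep; ↭-refl; ↭-trans; ↭-swap)
  open import Data.List.Relation.Binary.Permutation.Setoid.Properties setoid using (filter⁺; xs↭ys⇒|xs|≡|ys|)

  occurrences-↭ : ∀ {μ σ τ} → σ ↭ τ → occurrences μ σ ≡ occurrences μ τ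
  occurrences-↭ {μ} σ↭τ = xs↭ys⇒|xs|≡|ys| (filter⁺ (μ ≟_) (λ x≈y μ≈x → ≈-trans μ≈x x≈y) σ↭τ)

  extract : ∀ μ τ → 0 < occurrences μ τ → ∃[ τ′ ] τ ↭ μ ∷ τ′
  extract μ (ν ∷ τ) 0<occ with μ ≟ ν
  ... | yes μ≈ν = τ , prep (≈-sym μ≈ν) ↭-refl
  ... | no _ with τ′ , τ↭ ← extract μ τ 0<occ = ν ∷ τ′ , ↭-trans (prep ≈-refl τ↭) (↭-swap ν μ ↭-refl)

  occurrences-tail-≤ : ∀ ν μ σ τ → occurrences ν (μ ∷ σ) ≤ occurrences ν (μ ∷ τ) → occurrences ν σ ≤ occurrences ν τ
  occurrences-tail-≤ ν μ σ τ occ≤ with ν ≟ μ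
  ... | yes _ = s≤s⁻¹ occ≤
  ... | no _  = occ≤

  -- Induction on `σ`: its head occurs in `τ` because it occurs in `σ`. Removing one copy from each
  -- side preserves all the inequalities.
  occurrences-⊆ₘ : ∀ σ τ → (∀ μ → occurrences μ σ ≤ occurrences μ τ) → σ ⊆ₘ τ
  occurrences-⊆ₘ []      τ occ≤ = τ , ↭-refl
  occurrences-⊆ₘ (μ ∷ σ) τ occ≤
    with τ′ , τ↭ ← extract μ τ (ℕ.≤-trans (filter-some (μ ≟_) {μ ∷ σ} (here ≈-refl)) (occ≤ μ))
    with ρ , τ′↭ ← occurrences-⊆ₘ σ τ′ (λ ν → occurrences-tail-≤ ν μ σ τ′ (subst (occurrences ν (μ ∷ σ) ≤_) (occurrences-↭ τ↭) (occ≤ ν)))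
    = ρ , ↭-trans τ↭ (prep ≈-refl τ′↭)

theorem3p1 : ∀ {c ℓ₁ ℓ₂} (R : OrderedField c ℓ₁ ℓ₂) (n k : ℕ) → 1 ≤ k → k ≤ n →
    (k ≡ n → n ≡ 1) →
    (G : Graph (Fin n)) (σ τ : List (OrderedField.Carrier R)) →
    Spectral.IsLaplacianSpectrum R G σ →
    Spectral.IsLaplacianSpectrum R (tokenGraph k G) τ →
    Spectral._⊆ₘ_ R σ τ
theorem3p1 R n k 1≤k k≤n k≡n⇒n≡1 G σ τ σ-spectrum τ-spectrum = occurrences-⊆ₘ R σ τ λ μ →
  -- By `IsSpectrum`, the two occurrence counts of `μ` are the dimensions of its eigenspaces.
  eigenspace-dimension-≤ R (lift R) (lift-linComb R) (lift-injective R 1≤k k≤n k≡n⇒n≡1) (lift-eigen R G)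
    (σ-spectrum μ) (τ-spectrum μ)
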